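{- Let $\mathbf{f}$ be the Fibonacci word and let $\mathbf{cubes_f}$ be the infinite binary word whose $n$-th term ($n\ge 0$) is $1$ if a cube ends at position $n$ of $\mathbf{f}$ and $0$ otherwise. The (maximal) runs of $0$'s in $\mathbf{cubes_f}$ have lengths in $\{1,2,3,7,8,13\}$. The only run of length $13$ occurs at the beginning of $\mathbf{cubes_f}$ (i.e., starts at position $0$). For each of the lengths $1,2,3,7,8$ there are infinitely many runs of $0$'s of that length in $\mathbf{cubes_f}$.
   Context: The Fibonacci word is $\mathbf{f}=010010100100101001010010\cdots$, the fixed point of the morphism $0\mapsto 01$, $1\mapsto 0$; its letters are indexed starting from position $0$, and $\mathbf{f}[a..b]$ denotes the factor occupying positions $a$ through $b$. A cube is a word of the form $xxx$ with $x$ nonempty. A cube ends at position $j$ of $\mathbf{f}$ if there exist $i\ge 0$ and $m\ge 1$ with $j=i+3m-1$ such that $\mathbf{f}[i..j]=xxx$ for some word $x$ of length $m$. A run of $0$'s of length $\ell\ge1$ beginning at position $i$ in a binary word $\mathbf{u}=u_0u_1\cdots$ means $u_i=\cdots=u_{i+\ell-1}=0$, $u_{i+\ell}=1$, and either $i=0$ or $u_{i-1}=1$. -}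

module Defs where

open import Data.Nat using (ℕ; zero; suc; _+_; _*_; _<_; _≤_)
open import Data.List using (List; []; _∷_; _++_; concatMap)
open import Data.Product using (∃; ∃-syntax; _×_)
open import Data.Sum using (_⊎_)
open import Relation.Binary.PropositionalEquality using (_≡_)
open import Relation.Nullary using (¬_)

-- Letters are the natural numbers 0 and 1.
-- The Fibonacci morphism  0 ↦ 01 , 1 ↦ 0  (applied letterwise).
φ-letter : ℕ → List ℕ
φ-letter zero    = 0 ∷ 1 ∷ []
φ-letter (suc _) = 0 ∷ []

φ : List ℕ → List ℕ
φ = concatMap φ-letter

φ^_[0] : ℕ → List ℕ
φ^ zero  [0] = 0 ∷ []
φ^ suc k [0] = φ (φ^ k [0])

-- list lookup with a default value (never used out of range below)
at : List ℕ → ℕ → ℕ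
at []       _       = 0
at (x ∷ xs) zero    = x
at (x ∷ xs) (suc n) = at xs n

-- The Fibonacci word f = lim φ^k(0), indexed from 0.
-- φ^(n+1)(0) has length ≥ n+1 and is a prefix of f, so its n-th letter is f[n].
fib : ℕ → ℕ
fib n = at (φ^ suc n [0]) n

-- A cube ends at position j of f: there are i ≥ 0 and m ≥ 1 with j = i+3m-1
-- (i.e. j+1 = i+3m) and f[i..j] = xxx with |x| = m, i.e. f[i+k] = f[i+k+m] for k < 2m.
CubeEndsAt : ℕ → Set
CubeEndsAt j = ∃[ i ] ∃[ m ] (1 ≤ m × suc j ≡ i + 3 * m ×
                 (∀ k → k < 2 * m → fib (i + k) ≡ fib (i + k + m)))

-- The word cubes_f: its n-th letter is 1 iff CubeEndsAt n, and 0 otherwise.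
-- Hence  (cubes_f)_p = 0  ⟺  ¬ CubeEndsAt p ,  (cubes_f)_p = 1 ⟺ CubeEndsAt p.

ZeroRun : ℕ → ℕ → Set
ZeroRun i ℓ =
  1 ≤ ℓ ×
  (∀ k → k < ℓ → ¬ CubeEndsAt (i + k)) ×
  CubeEndsAt (i + ℓ) ×
  (i ≡ 0 ⊎ ∃[ p ] (i ≡ suc p × CubeEndsAt p))

{-# OPTIONS --safe #-}

-- Since f = φ(f), write L p for the position of f where the image of its letter at
-- position p begins. Let C(t) mean that some cube occupies positions up to but
-- excluding t. Cubes of f desubstitute to shorter cubes, with one exception: 01010, two
-- and a half periods, gives φ(01010)0 = (010)³. Conversely φ(xxx) is followed by the
-- first letter 0 of φ(x), so it yields two cubes. Hence
--   C(L p)       ⟺  C(p), or f[p-1] = 1 and C(p-1),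
--   C(L p + 1)   ⟺  C(p), or f[p-5..p-1] = 01010        (when f[p] = 0).
-- So the word of pairs (f[t], C(t)) is fixed by a sliding block version Ψ of φ. Its
-- factors of length 15 form a finite set closed under Ψ, from which the gaps between
-- consecutive cubes are read off. A gap recurs for ever because it lies in a factor w that
-- reappears inside Ψ(Ψ(w)).
module Submission where

open import Defs
open import Data.Bool using (Bool; true; false; _∧_; _∨_; not)
import Data.Bool.Properties as Bool
open import Data.Empty using (⊥; ⊥-elim)
open import Data.List using (List; []; _∷_; _++_; length; map; take; drop; replicate; upTo; deduplicate)
open import Data.List.Membership.DecPropositional using () renaming (_∈?_ to member?)
open import Data.List.Membership.Propositional using (_∈_)
open import Data.List.Membership.Propositional.Properties using (∈-upTo⁺; ∈-map⁺)
open import Data.List.Properties using (concatMap-++; ++-assoc; ++-identityʳ) renaming (≡-dec to List-≡-dec)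
open import Data.List.Relation.Unary.All as All using (All; all?)
open import Data.List.Relation.Unary.Any using (here; there)
open import Data.Maybe as Maybe using (Maybe; just; nothing)
import Data.Maybe.Properties as Maybe
open import Data.Nat
open import Data.Nat.Induction using (<-rec)
open import Data.Nat.Properties
open import Data.Nat.Tactic.RingSolver using (solve-∀)
open import Data.Product using (∃; ∃-syntax; _×_; _,_; proj₁; proj₂)
open import Data.Product.Properties using () renaming (≡-dec to ×-≡-dec)
open import Data.Sum using (_⊎_; inj₁; inj₂; [_,_]′)
open import Data.Unit using (⊤; tt)
open import Relation.Binary using (DecidableEquality; tri<; tri≈; tri>)
open import Relation.Binary.PropositionalEquality
open import Relation.Nullary using (¬_; Dec; does; yes; no; Reflects; ofʸ; ofⁿ)
open import Relation.Nullary.Decidable using (_×-dec_)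
open import Relation.Nullary.Reflects using (_×-reflects_; _⊎-reflects_)

-- The Fibonacci word as a fixed point of φ

at-++ : ∀ xs ys {n} → n < length xs → at (xs ++ ys) n ≡ at xs n
at-++ (x ∷ xs) ys {zero}  _         = refl
at-++ (x ∷ xs) ys {suc n} (s≤s n<) = at-++ xs ys n<

φ^-prefix : ∀ k → ∃[ v ] φ^ suc k [0] ≡ φ^ k [0] ++ v
φ^-prefix zero    = 1 ∷ [] , refl
φ^-prefix (suc k) with φ^-prefix k
... | v , eq = φ v , trans (cong φ eq) (concatMap-++ φ-letter (φ^ k [0]) v)

φ^-prefix-+ : ∀ d k → ∃[ v ] φ^ (d + k) [0] ≡ φ^ k [0] ++ v
φ^-prefix-+ zero    k = [] , sym (++-identityʳ _)
φ^-prefix-+ (suc d) k with φ^-prefix-+ d k | φ^-prefix (d + k)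
... | v , eq | u , eq′ = v ++ u , trans eq′ (trans (cong (_++ u) eq) (++-assoc (φ^ k [0]) v u))

length-φ : ∀ xs → length xs ≤ length (φ xs)
length-φ []           = z≤n
length-φ (zero ∷ xs)  = s≤s (m≤n⇒m≤1+n (length-φ xs))
length-φ (suc _ ∷ xs) = s≤s (length-φ xs)

φ^-head : ∀ k → ∃[ w ] φ^ k [0] ≡ 0 ∷ w
φ^-head k with φ^-prefix-+ k 0
... | v , eq = v , trans (cong (φ^_[0]) (sym (+-identityʳ k))) eq

-- The word starts with 0, whose image has two letters, while no image is empty; so each application
-- of φ adds at least one letter.
φ^-length : ∀ k → k < length (φ^ k [0])
φ^-length zero    = s≤s z≤n
φ^-length (suc k) with φ^ k [0] | φ^-head k | φ^-length k
... | _ | w , refl | k< = s≤s (≤-trans k< (s≤s (length-φ w)))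

-- Both `φ^ k [0]` and the word that defines `fib n` are prefixes of the same longer iterate, so
-- they agree wherever both are defined.
at-φ^ : ∀ k {n} → n < length (φ^ k [0]) → at (φ^ k [0]) n ≡ fib n
at-φ^ k {n} n< with φ^-prefix-+ (suc n) k | φ^-prefix-+ k (suc n)
... | v , eq | u , eq′ = begin
  at (φ^ k [0]) n           ≡⟨ at-++ (φ^ k [0]) v n< ⟨
  at (φ^ k [0] ++ v) n      ≡⟨ cong (λ w → at w n) eq ⟨
  at (φ^ (suc n + k) [0]) n ≡⟨ cong (λ j → at (φ^ j [0]) n) (+-comm (suc n) k) ⟩
  at (φ^ (k + suc n) [0]) n ≡⟨ cong (λ w → at w n) eq′ ⟩
  at (φ^ suc n [0] ++ u) n  ≡⟨ at-++ (φ^ suc n [0]) u (<-trans (n<1+n n) (φ^-length (suc n))) ⟩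
  fib n                     ∎
  where open ≡-Reasoning

at-φ-binary : ∀ xs n → at (φ xs) n ≡ 0 ⊎ at (φ xs) n ≡ 1
at-φ-binary []           n             = inj₁ refl
at-φ-binary (zero ∷ xs)  zero          = inj₁ refl
at-φ-binary (zero ∷ xs)  (suc zero)    = inj₂ refl
at-φ-binary (zero ∷ xs)  (suc (suc n)) = at-φ-binary xs n
at-φ-binary (suc _ ∷ xs) zero          = inj₁ refl
at-φ-binary (suc _ ∷ xs) (suc n)       = at-φ-binary xs n

-- An opaque copy of fib, so that unification does not unfold φ^ suc n [0].
opaque
  f : ℕ → ℕ
  f = fib

  f≡fib : ∀ n → f n ≡ fib n
  f≡fib n = refl

  f-binary : ∀ n → f n ≡ 0 ⊎ f n ≡ 1
  f-binary n = at-φ-binary (φ^ n [0]) n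

at-φ^-f : ∀ k {n} → n < length (φ^ k [0]) → at (φ^ k [0]) n ≡ f n
at-φ^-f k {n} n< = trans (at-φ^ k n<) (sym (f≡fib n))

-- Decomposition of f into blocks, the images of its letters

len : ℕ → ℕ
len zero    = 2
len (suc _) = 1

-- L p is the position of f at which the image φ(f[p]) begins.
L : ℕ → ℕ
L zero    = 0
L (suc p) = len (f p) + L p

-- The counterpart of `L` for finite words, where induction on the list is available. The value 0
-- for the empty list is only a default.
blockStart : List ℕ → ℕ → ℕ
blockStart _        zero    = 0
blockStart []       (suc p) = 0
blockStart (x ∷ xs) (suc p) = len x + blockStart xs p

blockStart-suc : ∀ xs p → p < length xs →
                 blockStart xs (suc p) ≡ len (at xs p) + blockStart xs p
blockStart-suc (x ∷ [])     zero    _        = refl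
blockStart-suc (x ∷ y ∷ xs) zero    _        = refl
blockStart-suc (x ∷ xs)     (suc p) (s≤s p<) = begin
  len x + blockStart xs (suc p)                ≡⟨ cong (len x +_) (blockStart-suc xs p p<) ⟩
  len x + (len (at xs p) + blockStart xs p)    ≡⟨ swap (len x) (len (at xs p)) _ ⟩
  len (at xs p) + (len x + blockStart xs p)    ∎
  where open ≡-Reasoning
        swap : ∀ a b c → a + (b + c) ≡ b + (a + c)
        swap = solve-∀

blockStart-L : ∀ k p → p ≤ length (φ^ k [0]) → blockStart (φ^ k [0]) p ≡ L p
blockStart-L k zero    _  = refl
blockStart-L k (suc p) p< =
  trans (blockStart-suc (φ^ k [0]) p p<)
        (cong₂ (λ x y → len x + y) (at-φ^-f k p<) (blockStart-L k p (<⇒≤ p<)))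

φ-start : ∀ xs p → p < length xs →
          blockStart xs p < length (φ xs) × at (φ xs) (blockStart xs p) ≡ 0
φ-start (zero ∷ xs)  zero    _        = s≤s z≤n , refl
φ-start (suc _ ∷ xs) zero    _        = s≤s z≤n , refl
φ-start (zero ∷ xs)  (suc p) (s≤s p<) with φ-start xs p p<
... | b< , eq = s≤s (s≤s b<) , eq
φ-start (suc _ ∷ xs) (suc p) (s≤s p<) with φ-start xs p p<
... | b< , eq = s≤s b< , eq

φ-second : ∀ xs p → p < length xs → at xs p ≡ 0 →
           suc (blockStart xs p) < length (φ xs) × at (φ xs) (suc (blockStart xs p)) ≡ 1
φ-second (zero ∷ xs)  zero    _        _ = s≤s (s≤s z≤n) , refl
φ-second (zero ∷ xs)  (suc p) (s≤s p<) z with φ-second xs p p< z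
... | b< , eq = s≤s (s≤s b<) , eq
φ-second (suc _ ∷ xs) (suc p) (s≤s p<) z with φ-second xs p p< z
... | b< , eq = s≤s b< , eq

f-L : ∀ p → f (L p) ≡ 0
f-L p with φ-start (φ^ p [0]) p (φ^-length p)
... | b< , eq rewrite blockStart-L p p (<⇒≤ (φ^-length p)) =
  trans (sym (at-φ^-f (suc p) b<)) eq

f-sucL : ∀ p → f p ≡ 0 → f (suc (L p)) ≡ 1
f-sucL p z with φ-second (φ^ p [0]) p (φ^-length p) (trans (at-φ^-f p (φ^-length p)) z)
... | b< , eq rewrite blockStart-L p p (<⇒≤ (φ^-length p)) =
  trans (sym (at-φ^-f (suc p) b<)) eq

L-suc₀ : ∀ {p} → f p ≡ 0 → L (suc p) ≡ 2 + L p
L-suc₀ {p} z = cong (λ x → len x + L p) z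

L-suc₁ : ∀ {p} → f p ≡ 1 → L (suc p) ≡ suc (L p)
L-suc₁ {p} z = cong (λ x → len x + L p) z

data Block : ℕ → Set where
  start  : ∀ p → Block (L p)
  second : ∀ p → f p ≡ 0 → Block (suc (L p))

block : ∀ n → Block n
block zero = start 0
block (suc n) with block n
... | second p z = subst Block (L-suc₀ z) (start (suc p))
... | start p with f-binary p
...   | inj₁ z = second p z
...   | inj₂ o = subst Block (L-suc₁ o) (start (suc p))

0≢1 : ∀ {n} → f n ≡ 0 → ¬ f n ≡ 1
0≢1 z o = 0≢1+n (trans (sym z) o)

L<L-suc : ∀ p → L p < L (suc p)
L<L-suc p with f-binary p
... | inj₁ z rewrite L-suc₀ z = m<n⇒m<1+n (n<1+n (L p))
... | inj₂ o rewrite L-suc₁ o = n<1+n (L p)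

L-mono-≤ : ∀ {p q} → p ≤ q → L p ≤ L q
L-mono-≤ {p} p≤q with m≤n⇒∃[o]m+o≡n p≤q
... | d , refl = go d
  where
    go : ∀ d → L p ≤ L (p + d)
    go zero    = ≤-reflexive (cong L (sym (+-identityʳ p)))
    go (suc d) rewrite +-suc p d = ≤-trans (go d) (<⇒≤ (L<L-suc (p + d)))

L-mono-< : ∀ {p q} → p < q → L p < L q
L-mono-< {p} p<q = <-≤-trans (L<L-suc p) (L-mono-≤ p<q)

L-cancel-< : ∀ {p q} → L p < L q → p < q
L-cancel-< Lp<Lq = ≰⇒> λ q≤p → <⇒≱ Lp<Lq (L-mono-≤ q≤p)

L-cancel-≤ : ∀ {p q} → L p ≤ L q → p ≤ q
L-cancel-≤ Lp≤Lq = ≮⇒≥ λ q<p → <⇒≱ (L-mono-< q<p) Lp≤Lq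

L-injective : ∀ {p q} → L p ≡ L q → p ≡ q
L-injective eq = ≤-antisym (L-cancel-≤ (≤-reflexive eq)) (L-cancel-≤ (≤-reflexive (sym eq)))

p≤L : ∀ p → p ≤ L p
p≤L zero    = z≤n
p≤L (suc p) = ≤-<-trans (p≤L p) (L<L-suc p)

f-sucL₁ : ∀ p → f p ≡ 1 → f (suc (L p)) ≡ 0
f-sucL₁ p o = trans (cong f (sym (L-suc₁ o))) (f-L (suc p))

f-sucL⁻¹₀ : ∀ p → f (suc (L p)) ≡ 1 → f p ≡ 0
f-sucL⁻¹₀ p o with f-binary p
... | inj₁ z = z
... | inj₂ o′ = ⊥-elim (0≢1 (f-sucL₁ p o′) o)

f-sucL⁻¹₁ : ∀ p → f (suc (L p)) ≡ 0 → f p ≡ 1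
f-sucL⁻¹₁ p z with f-binary p
... | inj₁ z′ = ⊥-elim (0≢1 z (f-sucL p z′))
... | inj₂ o  = o

-- The position after a block start determines the letter: it holds the 1 of the block 01, or the 0
-- that opens the next block.
f-sucL-cong⁻¹ : ∀ p q → f (suc (L p)) ≡ f (suc (L q)) → f p ≡ f q
f-sucL-cong⁻¹ p q eq with f-binary p
... | inj₁ z = trans z (sym (f-sucL⁻¹₀ q (trans (sym eq) (f-sucL p z))))
... | inj₂ o = trans o (sym (f-sucL⁻¹₁ q (trans (sym eq) (f-sucL₁ p o))))

block₀ : ∀ n → f n ≡ 0 → ∃[ p ] n ≡ L p
block₀ n z with block n
... | start p     = p , refl
... | second p z′ = ⊥-elim (0≢1 z (f-sucL p z′))

block₁ : ∀ n → f n ≡ 1 → ∃[ p ] (n ≡ suc (L p) × f p ≡ 0)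
block₁ n o with block n
... | start p    = ⊥-elim (0≢1 (f-L p) o)
... | second p z = p , refl , z

no-11 : ∀ n → f n ≡ 1 → f (suc n) ≡ 0
no-11 n o with block₁ n o
... | p , refl , z = trans (cong f (sym (L-suc₀ z))) (f-L (suc p))

-- The first 0 is a whole block, the image of 1. The next preimage letter is then 0, and its block
-- is 01.
no-000 : ∀ n → f n ≡ 0 → f (suc n) ≡ 0 → f (suc (suc n)) ≡ 1
no-000 n z z′ with block₀ n z
... | p , refl = subst (λ i → f (suc i) ≡ 1) (L-suc₁ o) (f-sucL (suc p) (no-11 p o))
  where o = f-sucL⁻¹₁ p z′

-- Periods, cubes and their transport along φ

-- A cube of period m starting at a is Per m a (a + m + m): the bound e limits x, not x + m.

Per : ℕ → ℕ → ℕ → Set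
Per m a e = ∀ x → a ≤ x → x < e → f x ≡ f (x + m)

-- t is an exclusive end: CubeTo (suc j) corresponds to CubeEndsAt j.
CubeTo : ℕ → Set
CubeTo t = ∃[ s ] ∃[ m ] (1 ≤ m × t ≡ s + m + m + m × Per m s (s + m + m))

Per-narrow : ∀ {m a e e′} → e′ ≤ e → Per m a e → Per m a e′
Per-narrow e′≤e per x a≤x x<e′ = per x a≤x (<-≤-trans x<e′ e′≤e)

Per-snoc : ∀ {m a e} → Per m a e → f e ≡ f (e + m) → Per m a (suc e)
Per-snoc per eq x a≤x (s≤s x≤e) with m≤n⇒m<n∨m≡n x≤e
... | inj₁ x<e  = per x a≤x x<e
... | inj₂ refl = eq

Per-cons : ∀ {m a e} → f a ≡ f (a + m) → Per m (suc a) e → Per m a e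
Per-cons eq per x a≤x x<e with m≤n⇒m<n∨m≡n a≤x
... | inj₁ a<x  = per x a<x x<e
... | inj₂ refl = eq

-- Block lengths depend only on the letters, so as long as these repeat with period `m` the distance
-- `d` between corresponding block starts is preserved.
L-shift : ∀ {s m d r} → L (s + m) ≡ L s + d → Per m s r →
          ∀ {q} → s ≤ q → q ≤ r → L (q + m) ≡ L q + d
L-shift {s} {m} {d} {r} eq per s≤q q≤r with m≤n⇒∃[o]m+o≡n s≤q
... | i , refl = go i q≤r
  where
    open ≡-Reasoning
    go : ∀ i → s + i ≤ r → L (s + i + m) ≡ L (s + i) + d
    go zero    _   rewrite +-identityʳ s = eq
    go (suc i) si< rewrite +-suc s i = begin
      len (f (s + i + m)) + L (s + i + m) ≡⟨ cong₂ (λ x y → len x + y) (sym (per (s + i) (m≤m+n s i) si<)) (go i (<⇒≤ si<)) ⟩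
      len (f (s + i)) + (L (s + i) + d)   ≡⟨ +-assoc (len (f (s + i))) (L (s + i)) d ⟨
      len (f (s + i)) + L (s + i) + d     ∎

-- The letter of a block is read off the position after its start, whence the strict bound.
desubstitute : ∀ {s m d e} → L (s + m) ≡ L s + d → Per d (L s) e →
               ∀ r → (∀ {q} → q < r → suc (L q) < e) → Per m s r
desubstitute {s} {m} {d} {e} eq per zero    _     x _   ()
desubstitute {s} {m} {d} {e} eq per (suc r) bound with s ≤? r
... | no s≰r  = λ x s≤x x≤r → ⊥-elim (s≰r (≤-trans s≤x (≤-pred x≤r)))
... | yes s≤r = Per-snoc ih (f-sucL-cong⁻¹ r (r + m) (begin
        f (suc (L r))       ≡⟨ per (suc (L r)) (m≤n⇒m≤1+n (L-mono-≤ s≤r)) (bound ≤-refl) ⟩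
        f (suc (L r + d))   ≡⟨ cong (λ i → f (suc i)) (L-shift {s} {m} {d} {r} eq ih s≤r ≤-refl) ⟨
        f (suc (L (r + m))) ∎))
  where
    open ≡-Reasoning
    ih = desubstitute {s} {m} {d} {e} eq per r (λ q<r → bound (m<n⇒m<1+n q<r))

-- A position holding 0 is a block start, so a period leading from one block start to a 0 spans
-- whole blocks.
period-preimage : ∀ s d → 1 ≤ d → f (L s + d) ≡ 0 → ∃[ m ] (1 ≤ m × L (s + m) ≡ L s + d)
period-preimage s d 1≤d z with block₀ (L s + d) z
... | u , eq with m≤n⇒∃[o]m+o≡n (L-cancel-< {s} {u} (subst (L s <_) eq (m<m+n (L s) 1≤d)))
...   | m , refl = suc m , s≤s z≤n , trans (cong L (+-suc s m)) (sym eq)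

P01010 : ℕ → Set
P01010 p = ∃[ s ] (p ≡ 5 + s × f s ≡ 0 × f (1 + s) ≡ 1 × f (2 + s) ≡ 0 × f (3 + s) ≡ 1 × f (4 + s) ≡ 0)

-- The third copy of the period fails in its last letter only. Desubstituting once more shows
-- that the period extends to the left, which gives a cube again, except for 010100.
almost-cube : ∀ {s m r} → 1 ≤ m → suc r ≡ s + m → Per m s (r + m) →
              f (r + m) ≡ 1 → f (r + m + m) ≡ 0 → CubeTo (r + m + m) ⊎ P01010 (r + m + m)
almost-cube {s} {m} {r} 1≤m end per last₂ last₃ = from-start fs≡0
  where
    open ≡-Reasoning

    s≤r : s ≤ r
    s≤r = ≤-pred (subst (suc s ≤_) (sym end) (m<m+n s 1≤m))

    r<r+m : r < r + m
    r<r+m = m<m+n r 1≤m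

    last₁ : f r ≡ 1
    last₁ = trans (per r s≤r r<r+m) last₂

    fs+m≡0 : f (s + m) ≡ 0
    fs+m≡0 = trans (cong f (sym end)) (no-11 r last₁)

    fs≡0 : f s ≡ 0
    fs≡0 = trans (per s ≤-refl (≤-<-trans s≤r r<r+m)) fs+m≡0

    from-start : f s ≡ 0 → CubeTo (r + m + m) ⊎ P01010 (r + m + m)
    from-start fs≡0 with block₀ s fs≡0
    ... | q , refl with period-preimage q m 1≤m fs+m≡0
    ... | suc z , _ , eq = by-letter (f-binary q)
      where
        -- The second desubstitution: `n` is the preimage of the period `m`, and `x` is the last
        -- position of the first copy one level down.
        x n : ℕ
        n = suc z
        x = q + z

        L-suc-x : L (suc x) ≡ suc r
        L-suc-x = trans (cong L (sym (+-suc q z))) (trans eq (sym end))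

        fx≡0 : f x ≡ 0
        fx≡0 with f-binary x
        ... | inj₁ fx≡0 = fx≡0
        ... | inj₂ fx≡1 = ⊥-elim (0≢1 (f-L x)
              (trans (cong f (suc-injective (trans (sym (L-suc₁ fx≡1)) L-suc-x))) last₁))

        r≡ : r ≡ suc (L x)
        r≡ = suc-injective (trans (sym L-suc-x) (L-suc₀ fx≡0))

        per₁ : Per n q (suc x)
        per₁ = desubstitute {q} {n} {m} eq per (suc x)
          λ q′≤x → ≤-<-trans (s≤s (L-mono-≤ (≤-pred q′≤x))) (subst (_< r + m) r≡ r<r+m)

        q≤x : q ≤ x
        q≤x = m≤m+n q z

        x<x+n : x < x + n
        x<x+n = m<m+n x (s≤s z≤n)

        L₂ : L (x + n) ≡ L x + m
        L₂ = L-shift {q} {n} {m} eq per₁ q≤x (n≤1+n x)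

        per₂ : Per n q (x + n)
        per₂ = desubstitute {q} {n} {m} eq per (x + n)
          λ q′< → ≤-<-trans (L-mono-< q′<) (≤-reflexive (trans (cong suc L₂) (cong (_+ m) (sym r≡))))

        L₃ : L (x + n + n) ≡ L x + m + m
        L₃ = trans (L-shift {q} {n} {m} eq per₂ (≤-trans q≤x (<⇒≤ x<x+n)) ≤-refl) (cong (_+ m) L₂)

        fx₃≡1 : f (x + n + n) ≡ 1
        fx₃≡1 = f-sucL⁻¹₁ (x + n + n) (begin
          f (suc (L (x + n + n))) ≡⟨ cong (λ i → f (suc i)) L₃ ⟩
          f (suc (L x) + m + m)   ≡⟨ cong (λ i → f (i + m + m)) r≡ ⟨
          f (r + m + m)           ≡⟨ last₃ ⟩
          0                       ∎)

        fq+n≡0 : f q ≡ 0 → f (q + n) ≡ 0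
        fq+n≡0 z = trans (sym (per₁ q ≤-refl (s≤s q≤x))) z

        by-letter : f q ≡ 0 ⊎ f q ≡ 1 → CubeTo (r + m + m) ⊎ P01010 (r + m + m)
        by-letter (inj₂ fq≡1) = inj₁ (extend-left q refl fq≡1)
          where
            -- The letter before `q` is 0, so position `L q - 1` holds 1, as does `r`. Shifting the
            -- start left by one makes up for the failing last letter.
            extend-left : ∀ q′ → q′ ≡ q → f q′ ≡ 1 → CubeTo (r + m + m)
            extend-left zero    _    fq≡1 = ⊥-elim (0≢1 (f-L 0) fq≡1)
            extend-left (suc p) refl fq≡1 = a , m , 1≤m , cong (λ i → i + m + m) (sym a+m≡r) ,
              subst (λ i → Per m a (i + m)) (sym a+m≡r)
                (Per-cons (trans fa≡1 (sym (trans (cong f a+m≡r) last₁)))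
                          (subst (λ i → Per m i (r + m)) (L-suc₀ fp≡0) per))
              where
                fp≡0 : f p ≡ 0
                fp≡0 with f-binary p
                ... | inj₁ fp≡0 = fp≡0
                ... | inj₂ fp≡1 = ⊥-elim (0≢1 (no-11 p fp≡1) fq≡1)

                a : ℕ
                a = suc (L p)

                fa≡1 : f a ≡ 1
                fa≡1 = f-sucL p fp≡0

                a+m≡r : a + m ≡ r
                a+m≡r = suc-injective (trans (cong (_+ m) (sym (L-suc₀ fp≡0))) (sym end))
        by-letter (inj₁ fq≡0) = inj₂ (by-period z refl)
          where
            by-period : ∀ k → k ≡ z → P01010 (r + m + m)
            -- Here `n` is 1, so `q` and `q + 1` both hold 0. Their images and the 0 that follows
            -- form 01010.
            by-period zero refl = L q , (begin
                r + m + m            ≡⟨ cong₂ (λ i j → i + j + j) r≡′ m≡2 ⟩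
                suc (L q) + 2 + 2    ≡⟨ cong suc (trans (+-assoc (L q) 2 2) (+-comm (L q) 4)) ⟩
                5 + L q              ∎) ,
                f-L q , f-sucL q fq≡0 ,
                trans (cong f (sym (L-suc₀ fq≡0))) (f-L (suc q)) ,
                trans (cong (λ i → f (suc i)) (sym (L-suc₀ fq≡0))) (f-sucL (suc q) f1+q≡0) ,
                trans (cong f (sym L-2+q)) (f-L (2 + q))
              where
                r≡′ : r ≡ suc (L q)
                r≡′ = trans r≡ (cong (λ i → suc (L i)) (+-identityʳ q))
                m≡2 : m ≡ 2
                m≡2 = +-cancelˡ-≡ (L q) m 2 (trans (sym end) (trans (cong suc r≡′) (+-comm 2 (L q))))
                f1+q≡0 : f (suc q) ≡ 0
                f1+q≡0 = trans (cong f (+-comm 1 q)) (fq+n≡0 fq≡0)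
                L-2+q : L (2 + q) ≡ 4 + L q
                L-2+q = trans (L-suc₀ f1+q≡0) (cong (2 +_) (L-suc₀ fq≡0))
            -- The letter at `y`, just before `x`, is 1, for otherwise 000 would occur at `y`. By
            -- periodicity `y + n + n` holds 1 too, and so does its successor `x + n + n`, which is
            -- impossible.
            by-period (suc k) refl = ⊥-elim (0≢1 (no-11 (y + n + n) fy₃≡1) (trans (cong (λ i → f (i + n + n)) (sym x≡)) fx₃≡1))
              where
                y : ℕ
                y = q + k

                x≡ : x ≡ suc y
                x≡ = +-suc q k

                fy≡1 : f y ≡ 1
                fy≡1 with f-binary y
                ... | inj₂ fy≡1 = fy≡1
                ... | inj₁ fy≡0 = ⊥-elim (0≢1 (fq+n≡0 fq≡0)
                  (trans (cong f (trans (+-suc q z) (cong suc x≡)))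
                         (no-000 y fy≡0 (trans (cong f (sym x≡)) fx≡0))))

                y<x : y < x
                y<x = ≤-reflexive (sym x≡)

                q≤y : q ≤ y
                q≤y = m≤m+n q k

                fy₃≡1 : f (y + n + n) ≡ 1
                fy₃≡1 = begin
                  f (y + n + n) ≡⟨ per₂ (y + n) (≤-trans q≤y (m≤m+n y n)) (+-monoˡ-< n y<x) ⟨
                  f (y + n)     ≡⟨ per₂ y q≤y (<-trans y<x x<x+n) ⟨
                  f y           ≡⟨ fy≡1 ⟩
                  1             ∎

-- Desubstitution of cubes

-- In `new`, the condition `f p ≡ 0` makes the letter after the cube a 1, which rules this case out
-- at block starts.
data Origin : ℕ → Set where
  image  : ∀ {p} → CubeTo p → Origin (L p)
  image⁺ : ∀ {p} → CubeTo p → Origin (suc (L p))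
  new    : ∀ {p} → f p ≡ 0 → P01010 p → Origin (suc (L p))

-- The copies are images of whole words, so all letters desubstitute except possibly the last one of
-- the third copy: if its counterpart in the second copy is 1, the letter that would decide it lies
-- just beyond the cube.
origin-at-start : ∀ s d → 1 ≤ d → Per d (L s) (L s + d + d) → Origin (L s + d + d + d)
origin-at-start s d 1≤d per
  with period-preimage s d 1≤d (trans (sym (per (L s) ≤-refl (<-trans Ls<₁ Ls<₂))) (f-L s))
  where
    Ls<₁ : L s < L s + d
    Ls<₁ = m<m+n (L s) 1≤d
    Ls<₂ : L s + d < L s + d + d
    Ls<₂ = m<m+n (L s + d) 1≤d
... | suc k , 1≤m , eq = by-last (f-binary r)
  where
    -- `r` is the last position of the second copy of the preimage period, and `r + m` that of the
    -- third.
    m r : ℕ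
    m = suc k
    r = s + k + m

    end : suc (s + k) ≡ s + m
    end = sym (+-suc s k)

    suc-r≡ : suc r ≡ s + m + m
    suc-r≡ = cong (_+ m) end

    s≤r : s ≤ r
    s≤r = ≤-trans (m≤m+n s k) (m≤m+n (s + k) m)

    L₂ : L (suc r) ≡ L s + d + d
    L₂ = trans (cong L suc-r≡)
      (trans (L-shift {s} {m} {d} eq per₁ (m≤m+n s m) ≤-refl) (cong (_+ d) eq))
      where
        per₁ : Per m s (s + m)
        per₁ = desubstitute {s} {m} {d} eq per (s + m) λ q< →
          ≤-<-trans (≤-trans (L-mono-< q<) (≤-reflexive eq)) (m<m+n (L s + d) 1≤d)

    L₃ : Per m s r → L (r + m) ≡ L r + d
    L₃ per′ = L-shift {s} {m} {d} eq per′ s≤r ≤-refl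

    full : Per m s (suc r) → Origin (L s + d + d + d)
    full per′ = subst Origin
      (trans (L-shift {s} {m} {d} eq per′ (m≤n⇒m≤1+n s≤r) ≤-refl) (cong (_+ d) L₂))
      (image (s , m , 1≤m , cong (_+ m) suc-r≡ , subst (Per m s) suc-r≡ per′))

    by-last : f r ≡ 0 ⊎ f r ≡ 1 → Origin (L s + d + d + d)
    by-last (inj₁ fr≡0) = full (desubstitute {s} {m} {d} eq per (suc r) λ q≤r →
      ≤-trans (s≤s (s≤s (L-mono-≤ (≤-pred q≤r)))) (≤-reflexive (trans (sym (L-suc₀ fr≡0)) L₂)))
    by-last (inj₂ fr≡1) = by-next (f-binary (r + m))
      where
        L-r : suc (L r) ≡ L s + d + d
        L-r = trans (sym (L-suc₁ fr≡1)) L₂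

        per′ : Per m s r
        per′ = desubstitute {s} {m} {d} eq per r λ q<r →
          ≤-trans (s≤s (L-mono-< q<r)) (≤-reflexive L-r)

        at-end : suc (L (r + m)) ≡ L s + d + d + d
        at-end = trans (cong suc (L₃ per′)) (cong (_+ d) L-r)

        by-next : f (r + m) ≡ 0 ⊎ f (r + m) ≡ 1 → Origin (L s + d + d + d)
        by-next (inj₂ next) = full (Per-snoc per′ (trans fr≡1 (sym next)))
        by-next (inj₁ next) = subst Origin at-end
          ([ image⁺ , new next ]′ (almost-cube 1≤m end per′ fr≡1 next))

-- A cube that starts at the second letter of a block starts with 1, and so does its second copy.
-- Both are preceded by 0, so the period extends one position left, to a block start.
origin : ∀ {t} → CubeTo t → Origin t
origin (a , d , 1≤d , refl , per) with block a
... | start s = origin-at-start s d 1≤d per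
... | second s fs≡0 with block₁ (suc (L s) + d) f≡1
  where
    f≡1 : f (suc (L s) + d) ≡ 1
    f≡1 = trans (sym (per (suc (L s)) ≤-refl (≤-trans (m<m+n (suc (L s)) 1≤d) (m≤m+n _ d)))) (f-sucL s fs≡0)
... | u , u≡ , _ = from-preimage (period-preimage s d 1≤d fd≡0)
  where
    fd≡0 : f (L s + d) ≡ 0
    fd≡0 = trans (cong f (suc-injective u≡)) (f-L u)

    per⁺ : Per d (L s) (suc (L s + d + d))
    per⁺ = Per-cons (trans (f-L s) (sym fd≡0)) per

    from-preimage : ∃[ m ] (1 ≤ m × L (s + m) ≡ L s + d) → Origin (suc (L s + d + d + d))
    from-preimage (m , 1≤m , eq) =
      subst (λ i → Origin (suc i)) L₃ (image⁺ (s , m , 1≤m , refl , per₂))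
      where
        per₁ : Per m s (s + m)
        per₁ = desubstitute {s} {m} {d} eq per⁺ (s + m) λ q< →
          s≤s (≤-trans (L-mono-< q<) (≤-trans (≤-reflexive eq) (m≤m+n (L s + d) d)))

        L₂ : L (s + m + m) ≡ L s + d + d
        L₂ = trans (L-shift {s} {m} {d} eq per₁ (m≤m+n s m) ≤-refl) (cong (_+ d) eq)

        per₂ : Per m s (s + m + m)
        per₂ = desubstitute {s} {m} {d} eq per⁺ (s + m + m) λ q< →
          s≤s (≤-trans (L-mono-< q<) (≤-reflexive L₂))

        L₃ : L (s + m + m + m) ≡ L s + d + d + d
        L₃ = trans (L-shift {s} {m} {d} eq per₂ (≤-trans (m≤m+n s m) (m≤m+n _ m)) ≤-refl)
                   (cong (_+ d) L₂)

-- φ(xxx) is always followed by 0, the first letter of φ(x), so it yields two cubes.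
φ-cube : ∀ {p} → CubeTo p → CubeTo (L p) × CubeTo (suc (L p))
φ-cube (s , m , 1≤m , refl , per) with m≤n⇒∃[o]m+o≡n (<⇒≤ (L-mono-< (m<m+n s 1≤m)))
... | d , eq′ =
    (L s , d , 1≤d , L₃ , Per-narrow (n≤1+n _) per′)
  , (suc (L s) , d , 1≤d , cong suc L₃ , λ x a≤x x<e → per′ x (≤-trans (n≤1+n _) a≤x) x<e)
  where
    eq : L (s + m) ≡ L s + d
    eq = sym eq′

    shift : ∀ {q} → s ≤ q → q ≤ s + m + m → L (q + m) ≡ L q + d
    shift = L-shift {s} {m} {d} eq per

    1≤d : 1 ≤ d
    1≤d = +-cancelˡ-< (L s) 0 d (subst₂ _<_ (sym (+-identityʳ (L s))) eq (L-mono-< (m<m+n s 1≤m)))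

    s≤₂ : s ≤ s + m + m
    s≤₂ = ≤-trans (m≤m+n s m) (m≤m+n _ m)

    L₂ : L (s + m + m) ≡ L s + d + d
    L₂ = trans (shift (m≤m+n s m) (m≤m+n _ m)) (cong (_+ d) eq)

    L₃ : L (s + m + m + m) ≡ L s + d + d + d
    L₃ = trans (shift s≤₂ ≤-refl) (cong (_+ d) L₂)

    -- The bound exceeds that of a cube by one: at `L s + d + d` both compared positions are block
    -- starts and hold 0. Dropping the last or the first position leaves the two cubes.
    per′ : Per d (L s) (suc (L s + d + d))
    per′ x a≤x (s≤s x≤e) with block x
    ... | start q = trans (f-L q) (sym (trans (cong f (sym (shift s≤q q≤e))) (f-L (q + m))))
      where
        s≤q : s ≤ q
        s≤q = L-cancel-≤ a≤x
        q≤e : q ≤ s + m + m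
        q≤e = L-cancel-≤ (≤-trans x≤e (≤-reflexive (sym L₂)))
    ... | second q fq≡0 = trans (f-sucL q fq≡0)
            (sym (trans (cong (λ i → f (suc i)) (sym (shift s≤q (<⇒≤ q<e))))
                        (f-sucL (q + m) (trans (sym (per q s≤q q<e)) fq≡0))))
      where
        s≤q : s ≤ q
        s≤q = ≤-pred (L-cancel-< (≤-<-trans a≤x (≤-reflexive (sym (L-suc₀ fq≡0)))))
        q<e : q < s + m + m
        q<e = L-cancel-< (≤-trans x≤e (≤-reflexive (sym L₂)))

-- φ(01010)0 = 010·010·010
new-cube : ∀ {p} → P01010 p → CubeTo (suc (L p))
new-cube (s , refl , z₀ , o₁ , z₂ , o₃ , z₄) =
  L s , 3 , s≤s z≤n , trans (cong suc L₅) (shape (L s)) , per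
  where
    shape : ∀ a → suc (8 + a) ≡ a + 3 + 3 + 3
    shape = solve-∀
    L₁ : L (1 + s) ≡ 2 + L s
    L₁ = L-suc₀ z₀
    L₂ : L (2 + s) ≡ 3 + L s
    L₂ = trans (L-suc₁ o₁) (cong suc L₁)
    L₃ : L (3 + s) ≡ 5 + L s
    L₃ = trans (L-suc₀ z₂) (cong (2 +_) L₂)
    L₄ : L (4 + s) ≡ 6 + L s
    L₄ = trans (L-suc₁ o₃) (cong suc L₃)
    L₅ : L (5 + s) ≡ 8 + L s
    L₅ = trans (L-suc₀ z₄) (cong (2 +_) L₄)
    zero-at : ∀ {i p} → L p ≡ i → f i ≡ 0
    zero-at {p = p} refl = f-L p
    one-at : ∀ {i p} → L p ≡ i → f p ≡ 0 → f (suc i) ≡ 1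
    one-at {p = p} refl z = f-sucL p z

    letters : ∀ i → i < 6 → f (i + L s) ≡ f (3 + i + L s)
    letters 0 _ = trans (f-L s) (sym (zero-at L₂))
    letters 1 _ = trans (one-at {p = s} refl z₀) (sym (one-at L₂ z₂))
    letters 2 _ = trans (zero-at L₁) (sym (zero-at L₃))
    letters 3 _ = trans (zero-at L₂) (sym (zero-at L₄))
    letters 4 _ = trans (one-at L₂ z₂) (sym (one-at L₄ z₄))
    letters 5 _ = trans (zero-at L₃) (sym (zero-at L₅))
    letters (suc (suc (suc (suc (suc (suc i)))))) (s≤s (s≤s (s≤s (s≤s (s≤s (s≤s ()))))))

    per : Per 3 (L s) (L s + 3 + 3)
    per x a≤x x<e with m≤n⇒∃[o]m+o≡n a≤x
    ... | i , refl = trans (cong f (+-comm (L s) i)) (trans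
          (letters i (+-cancelˡ-< (L s) i 6 (subst (L s + i <_) (+-assoc (L s) 3 3) x<e)))
          (cong f (reorder (L s) i)))
      where
        reorder : ∀ a i → 3 + i + a ≡ a + i + 3
        reorder = solve-∀

-- The sliding block substitution Ψ

-- A block start holds 0, which excludes `new`. In `image⁺` the end is one past the start of block
-- `q`, so that block is a single 0 and `f q` is 1.
cube-at-L : ∀ {p t} → CubeTo t → t ≡ L p → CubeTo p ⊎ ∃[ q ] (p ≡ suc q × f q ≡ 1 × CubeTo q)
cube-at-L {p} cube t≡ with origin cube
... | image c = inj₁ (subst CubeTo (L-injective t≡) c)
... | image⁺ {q} c = inj₂ (q , L-injective (trans (sym t≡) (sym (L-suc₁ fq≡1))) , fq≡1 , c)
  where fq≡1 = f-sucL⁻¹₁ q (trans (cong f t≡) (f-L p))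
... | new {q} z _ = ⊥-elim (0≢1 (trans (cong f t≡) (f-L p)) (f-sucL q z))

cube-at-sucL : ∀ {p t} → f p ≡ 0 → CubeTo t → t ≡ suc (L p) → CubeTo p ⊎ P01010 p
cube-at-sucL {p} z cube t≡ with origin cube
... | image {q} _ = ⊥-elim (0≢1 (f-L q) (trans (cong f t≡) (f-sucL p z)))
... | image⁺ c = inj₁ (subst CubeTo (L-injective (suc-injective t≡)) c)
... | new _ c = inj₂ (subst P01010 (L-injective (suc-injective t≡)) c)

map-reflects : ∀ {A B : Set} {b} → (A → B) → (B → A) → Reflects A b → Reflects B b
map-reflects to from (ofʸ a)  = ofʸ (to a)
map-reflects to from (ofⁿ ¬a) = ofⁿ λ b → ¬a (from b)

-- A letter pairs f[n] with the truth value of CubeTo n. Indices are shifted by 5 and five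
-- inert letters are put in front, so that every letter has five predecessors.

Letter : Set
Letter = ℕ × Bool

data Reads : ℕ → Letter → Set where
  -- The letter 1 prevents an inert position from opening 01010, and `false` prevents it from
  -- counting as the end of a cube.
  pad    : ∀ {i} → i < 5 → Reads i (1 , false)
  letter : ∀ {n x b} → f n ≡ x → Reflects (CubeTo n) b → Reads (5 + n) (x , b)

infixr 5 _∷_
data Occurs : ℕ → List Letter → Set where
  []  : ∀ {i} → Occurs i []
  _∷_ : ∀ {i a w} → Reads i a → Occurs (suc i) w → Occurs i (a ∷ w)

read : ∀ {n x b} → Reads (5 + n) (x , b) → f n ≡ x × Reflects (CubeTo n) b
read (pad 5+n<5)   = ⊥-elim (m+n≮m 5 _ 5+n<5)
read (letter fn c) = fn , c

isZero : ℕ → Bool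
isZero zero    = true
isZero (suc _) = false

isOne : ℕ → Bool
isOne x = not (isZero x)

reflects-0 : ∀ {n x b} → Reads (5 + n) (x , b) → Reflects (f n ≡ 0) (isZero x)
reflects-0 {x = x} r with x | read r
... | zero  | eq , _ = ofʸ eq
... | suc _ | eq , _ = ofⁿ λ z → 0≢1+n (trans (sym z) eq)

reflects-1 : ∀ {n x b} → Reads (5 + n) (x , b) → Reflects (f n ≡ 1) (isOne x)
reflects-1 {n} {x} r with x | read r | f-binary n
... | zero  | eq , _ | _      = ofⁿ λ o → 0≢1+n (trans (sym eq) o)
... | suc _ | eq , _ | inj₁ z = ⊥-elim (0≢1+n (trans (sym z) eq))
... | suc _ | eq , _ | inj₂ o = ofʸ o

reflects-at-L : ∀ {p y c x b} → Reads (4 + p) (y , c) → Reads (5 + p) (x , b) →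
                Reflects (CubeTo (L p)) (b ∨ (isOne y ∧ c))
reflects-at-L {p} r r′ = map-reflects
    [ (λ c → proj₁ (φ-cube c)) , (λ { (q , refl , o , c) → subst CubeTo (sym (L-suc₁ o)) (proj₂ (φ-cube c)) }) ]′
    (λ c → cube-at-L c refl)
    (proj₂ (read r′) ⊎-reflects preceding r)
  where
    preceding : ∀ {y c p} → Reads (4 + p) (y , c) →
                Reflects (∃[ q ] (p ≡ suc q × f q ≡ 1 × CubeTo q)) (isOne y ∧ c)
    preceding {p = zero}  (pad _) = ofⁿ λ ()
    preceding {p = suc p} r = map-reflects
      (λ { (o , c) → p , refl , o , c }) (λ { (_ , refl , o , c) → o , c })
      (reflects-1 r ×-reflects proj₂ (read r))

is01010 : ℕ → ℕ → ℕ → ℕ → ℕ → Bool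
is01010 x₀ x₁ x₂ x₃ x₄ = isZero x₀ ∧ isOne x₁ ∧ isZero x₂ ∧ isOne x₃ ∧ isZero x₄

reflects-01010 : ∀ {p x₀ x₁ x₂ x₃ x₄ b₀ b₁ b₂ b₃ b₄} →
  Reads p (x₀ , b₀) → Reads (1 + p) (x₁ , b₁) → Reads (2 + p) (x₂ , b₂) →
  Reads (3 + p) (x₃ , b₃) → Reads (4 + p) (x₄ , b₄) →
  Reflects (P01010 p) (is01010 x₀ x₁ x₂ x₃ x₄)
reflects-01010 (pad p<5) _ _ _ _ = ofⁿ λ { (s , refl , _) → m+n≮m 5 s p<5 }
reflects-01010 r₀@(letter _ _) r₁ r₂ r₃ r₄ = map-reflects
  (λ ls → _ , refl , ls) (λ { (_ , refl , ls) → ls })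
  (reflects-0 r₀ ×-reflects reflects-1 r₁ ×-reflects reflects-0 r₂ ×-reflects
   reflects-1 r₃ ×-reflects reflects-0 r₄)

-- The last argument is the letter being replaced; the five before it are its context.
ψ : Letter → Letter → Letter → Letter → Letter → Letter → List Letter
ψ (x₀ , _) (x₁ , _) (x₂ , _) (x₃ , _) (x₄ , c) (zero , b) =
  (0 , b ∨ (isOne x₄ ∧ c)) ∷ (1 , b ∨ is01010 x₀ x₁ x₂ x₃ x₄) ∷ []
ψ _ _ _ _ (x₄ , c) (suc _ , b) = (0 , b ∨ (isOne x₄ ∧ c)) ∷ []

Ψ : List Letter → List Letter
Ψ (a₀ ∷ w@(a₁ ∷ a₂ ∷ a₃ ∷ a₄ ∷ a ∷ _)) = ψ a₀ a₁ a₂ a₃ a₄ a ++ Ψ w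
Ψ _ = []

at-index : ∀ {i j w} → i ≡ j → Occurs i w → Occurs j w
at-index refl o = o

Ψ-occurs-∷ : ∀ {y a w} → Reads y a → Occurs (suc y) w →
             Occurs (5 + L (suc y)) (Ψ w) → Occurs (5 + L y) (Ψ (a ∷ w))
Ψ-occurs-∷ _ [] _ = []
Ψ-occurs-∷ _ (_ ∷ []) _ = []
Ψ-occurs-∷ _ (_ ∷ _ ∷ []) _ = []
Ψ-occurs-∷ _ (_ ∷ _ ∷ _ ∷ []) _ = []
Ψ-occurs-∷ _ (_ ∷ _ ∷ _ ∷ _ ∷ []) _ = []
Ψ-occurs-∷ {y} {w = _ ∷ _ ∷ _ ∷ _ ∷ (zero , _) ∷ _} r₀ (r₁ ∷ r₂ ∷ r₃ ∷ r₄ ∷ r ∷ _) o =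
    letter (f-L y) (reflects-at-L r₄ r)
  ∷ letter (f-sucL y fy≡0) (map-reflects
      [ (λ c → proj₂ (φ-cube c)) , new-cube ]′ (λ c → cube-at-sucL fy≡0 c refl)
      (proj₂ (read r) ⊎-reflects reflects-01010 r₀ r₁ r₂ r₃ r₄))
  ∷ at-index (cong (5 +_) (L-suc₀ fy≡0)) o
  where fy≡0 = proj₁ (read r)
Ψ-occurs-∷ {y} {w = _ ∷ _ ∷ _ ∷ _ ∷ (suc _ , _) ∷ _} _ (_ ∷ _ ∷ _ ∷ r₄ ∷ r ∷ _) o =
    letter (f-L y) (reflects-at-L r₄ r)
  ∷ at-index (cong (λ x → 5 + (len x + L y)) (proj₁ (read r))) o

-- The sixth letter of `w` is the first with a full context. It has shifted index `5 + y`, hence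
-- position `y` in f, and its block starts at `L y`.
Ψ-occurs : ∀ {y w} → Occurs y w → Occurs (5 + L y) (Ψ w)
Ψ-occurs []      = []
Ψ-occurs (r ∷ o) = Ψ-occurs-∷ r o (Ψ-occurs o)

take-occurs : ∀ {y w} n → Occurs y w → Occurs y (take n w)
take-occurs zero    _       = []
take-occurs (suc n) []      = []
take-occurs (suc n) (r ∷ o) = r ∷ take-occurs n o

drop-occurs : ∀ {y w} n → Occurs y w → Occurs (n + y) (drop n w)
drop-occurs zero    o       = o
drop-occurs (suc n) []      = []
drop-occurs {y} (suc n) (r ∷ o) = at-index (+-suc n y) (drop-occurs n o)

inert : List Letter
inert = replicate 5 (1 , false)

-- The decorated form of `φ^ k [0]`. As `Ψ` emits nothing for the first five letters, the inert ones
-- are put back each time.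
prefix : ℕ → List Letter
prefix zero    = inert ++ (0 , false) ∷ []
prefix (suc k) = inert ++ Ψ (prefix k)

inert-occurs : ∀ {w} → Occurs 5 w → Occurs 0 (inert ++ w)
inert-occurs o = pad (s≤s z≤n) ∷ pad (s≤s (s≤s z≤n)) ∷ pad (s≤s (s≤s (s≤s z≤n))) ∷
  pad (s≤s (s≤s (s≤s (s≤s z≤n)))) ∷ pad ≤-refl ∷ o

prefix-occurs : ∀ k → Occurs 0 (prefix k)
prefix-occurs zero    = inert-occurs (letter (f-L 0) (ofⁿ no-cube) ∷ [])
  where
    no-cube : ¬ CubeTo 0
    no-cube (s , suc m , _ , eq , _) = 0≢1+n (trans eq (+-suc _ m))
prefix-occurs (suc k) = inert-occurs (Ψ-occurs (prefix-occurs k))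

-- Gaps between cubes

FirstCube : ℕ → ℕ → Set
FirstCube n g = (∀ k → k < g → ¬ CubeTo (n + k)) × CubeTo (n + g)

FirstCube-unique : ∀ {n g h} → FirstCube n g → FirstCube n h → g ≡ h
FirstCube-unique {n} {g} {h} (none-g , c-g) (none-h , c-h) with <-cmp g h
... | tri< g<h _ _ = ⊥-elim (none-h g g<h c-g)
... | tri≈ _ g≡h _ = g≡h
... | tri> _ _ h<g = ⊥-elim (none-g h h<g c-h)

firstCube : List Letter → Maybe ℕ
firstCube []                = nothing
firstCube ((_ , true) ∷ _)  = just 0
firstCube ((_ , false) ∷ w) = Maybe.map suc (firstCube w)

firstCube-sound : ∀ {n g} w → Occurs (5 + n) w → firstCube w ≡ just g → FirstCube n g
firstCube-sound {n} ((_ , true) ∷ _) (r ∷ _) refl with read r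
... | _ , ofʸ c = (λ _ ()) , subst CubeTo (sym (+-identityʳ n)) c
firstCube-sound {n} ((_ , false) ∷ w) (r ∷ o) eq with firstCube w in eq′ | eq | read r
... | just g | refl | _ , ofⁿ ¬c with firstCube-sound w o eq′
...   | none , c = none′ , subst CubeTo (sym (+-suc n g)) c
  where
    none′ : ∀ k → k < suc g → ¬ CubeTo (n + k)
    none′ zero    _         c = ¬c (subst CubeTo (+-identityʳ n) c)
    none′ (suc k) (s≤s k<g) c = none k k<g (subst CubeTo (+-suc n k) c)

nextCube : List Letter → Maybe ℕ
nextCube ((_ , true) ∷ w) = firstCube w
nextCube _                = nothing

nextCube-sound : ∀ {n g} w → Occurs (5 + n) w → nextCube w ≡ just g → CubeTo n × FirstCube (suc n) g
nextCube-sound ((_ , true) ∷ w) (r ∷ o) eq with read r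
... | _ , ofʸ c = c , firstCube-sound w o eq

-- Finite check over the factors of length 15

-- Large closed terms are compared through does, which is evaluated with sharing.
by-evaluation : ∀ {A : Set} (a? : Dec A) → does a? ≡ true → A
by-evaluation (yes a) _ = a

_≟ᵐ_ : DecidableEquality (Maybe ℕ)
_≟ᵐ_ = Maybe.≡-dec _≟_

_≟ʷ_ : DecidableEquality (List Letter)
_≟ʷ_ = List-≡-dec (×-≡-dec _≟_ Bool._≟_)

-- Length 15 leaves ten letters with full context; ten consecutive letters of f include at least six
-- 0's, so their image has at least 16 letters and holds the windows at offsets 0 and 1.
window : ℕ → List Letter → List Letter
window y w = take 15 (drop y w)

windows : ℕ → List Letter → List (List Letter)
windows n w = map (λ y → window y w) (upTo n)

Closed : List (List Letter) → Set
Closed S = All (λ w → window 0 (Ψ w) ∈ S × window 1 (Ψ w) ∈ S) S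

Gap : ℕ → Set
Gap g = g ≡ 1 ⊎ g ≡ 2 ⊎ g ≡ 3 ⊎ g ≡ 7 ⊎ g ≡ 8

HasGap : List Letter → Set
HasGap []                = ⊥
HasGap ((_ , false) ∷ _) = ⊤
HasGap ((_ , true) ∷ w)  = firstCube w ∈ map just (0 ∷ 1 ∷ 2 ∷ 3 ∷ 7 ∷ 8 ∷ [])

Complete : List (List Letter) → Set
Complete S = All (_∈ S) (windows 5 (prefix 14)) × Closed S × All HasGap S

complete? : ∀ S → Dec (Complete S)
complete? S = all? (_∈? S) (windows 5 (prefix 14))
    ×-dec all? (λ w → (window 0 (Ψ w) ∈? S) ×-dec (window 1 (Ψ w) ∈? S)) S
    ×-dec all? hasGap? S
  where
    _∈?_ = member? _≟ʷ_
    hasGap? : ∀ w → Dec (HasGap w)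
    hasGap? []                = no λ ()
    hasGap? ((_ , false) ∷ _) = yes tt
    hasGap? ((_ , true) ∷ w)  = member? _≟ᵐ_ (firstCube w) _

-- Strong induction: position `n` of f lies at offset 0 or 1 of the block of some `p`, and the
-- window at the smaller index `p` yields the one at `5 + n` under `Ψ`. The windows that start with
-- inert letters are the base case.
cover : ∀ {S} → Complete S → ∀ y → ∃[ w ] (w ∈ S × Occurs y w)
cover {S} (initial , closed , _) = <-rec _ step
  where
    step : ∀ y → (∀ {z} → z < y → ∃[ w ] (w ∈ S × Occurs z w)) → ∃[ w ] (w ∈ S × Occurs y w)
    step y ih with y <? 5
    ... | yes y<5 = _ , All.lookup initial (∈-map⁺ (λ z → window z (prefix 14)) (∈-upTo⁺ y<5)) ,
            take-occurs 15 (at-index (+-identityʳ y) (drop-occurs y (prefix-occurs 14)))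
    ... | no y≮5 with m≤n⇒∃[o]m+o≡n (≮⇒≥ y≮5)
    ...   | n , refl with block n
    ...     | start p with ih {p} (≤-<-trans (p≤L p) (m<n+m (L p) (s≤s z≤n)))
    ...       | w , w∈S , o = _ , proj₁ (All.lookup closed w∈S) , take-occurs 15 (Ψ-occurs o)
    step y ih | no y≮5 | n , refl | second p _ with ih {p} (≤-<-trans (p≤L p) (m<n+m (L p) {6} (s≤s z≤n)))
    ...       | w , w∈S , o = _ , proj₂ (All.lookup closed w∈S) , take-occurs 15 (drop-occurs 1 (Ψ-occurs o))

listed : ∀ {m} → m ∈ map just (0 ∷ 1 ∷ 2 ∷ 3 ∷ 7 ∷ 8 ∷ []) → ∃[ g ] ((g ≡ 0 ⊎ Gap g) × m ≡ just g)
listed (here eq)                                         = 0 , inj₁ refl , eq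
listed (there (here eq))                                 = 1 , inj₂ (inj₁ refl) , eq
listed (there (there (here eq)))                         = 2 , inj₂ (inj₂ (inj₁ refl)) , eq
listed (there (there (there (here eq))))                 = 3 , inj₂ (inj₂ (inj₂ (inj₁ refl))) , eq
listed (there (there (there (there (here eq)))))         = 7 , inj₂ (inj₂ (inj₂ (inj₂ (inj₁ refl)))) , eq
listed (there (there (there (there (there (here eq)))))) = 8 , inj₂ (inj₂ (inj₂ (inj₂ (inj₂ refl)))) , eq

complete⇒next-gap : ∀ {S} → Complete S → ∀ {n} → CubeTo n → ∃[ g ] (FirstCube (suc n) g × (g ≡ 0 ⊎ Gap g))
complete⇒next-gap {S} complete@(_ , _ , gaps) {n} c with cover complete (5 + n)
... | w , w∈S , o = go w o (All.lookup gaps w∈S)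
  where
    go : ∀ w → Occurs (5 + n) w → HasGap w → ∃[ g ] (FirstCube (suc n) g × (g ≡ 0 ⊎ Gap g))
    go ((_ , false) ∷ _) (r ∷ _) _ with read r
    ... | _ , ofⁿ ¬c = ⊥-elim (¬c c)
    go ((_ , true) ∷ w) (_ ∷ o) gap with listed gap
    ... | g , g-listed , eq = g , firstCube-sound w o eq , g-listed

-- The first occurrence of a factor of length 15 lies among the first 660 positions.
factors : List (List Letter)
factors = deduplicate _≟ʷ_ (windows 660 (prefix 14))

-- Opaque, because with-abstraction would normalise the proof.
opaque
  next-gap : ∀ {n} → CubeTo n → ∃[ g ] (FirstCube (suc n) g × (g ≡ 0 ⊎ Gap g))
  next-gap = complete⇒next-gap {factors} (by-evaluation (complete? factors) refl)

first-cube : FirstCube 1 13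
-- Six letters are dropped: the five inert ones and the exclusive end 0, which belongs to no
-- position.
first-cube = firstCube-sound (drop 6 (prefix 14)) (drop-occurs 6 (prefix-occurs 14))
  (by-evaluation (firstCube (drop 6 (prefix 14)) ≟ᵐ just 13) refl)

-- Recurrence of factors

Recurrent : List Letter → Set
Recurrent w = ∀ N → ∃[ y ] (N ≤ y × Occurs y w)

-- Each occurrence yields another inside its double image, and this one starts strictly later
-- because `L` never decreases an index and the shift adds to it.
recurrent : ∀ {w y} d n → Occurs y w → take n (drop d (Ψ (Ψ w))) ≡ w → Recurrent w
recurrent {y = y} d n o eq zero = y , z≤n , o
recurrent {w} d n o eq (suc N) with recurrent {w} d n o eq N
... | y , N≤y , o′ = _ , later , subst (Occurs _) eq (take-occurs n (drop-occurs d (Ψ-occurs (Ψ-occurs o′))))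
  where
    open ≤-Reasoning
    y′ : ℕ
    y′ = 5 + L y
    later : suc N ≤ d + (5 + L y′)
    later = begin
      suc N          ≤⟨ s≤s N≤y ⟩
      suc y          ≤⟨ s≤s (p≤L y) ⟩
      suc (L y)      ≤⟨ m≤n+m (suc (L y)) 4 ⟩
      y′             ≤⟨ p≤L y′ ⟩
      L y′           ≤⟨ m≤n+m (L y′) 5 ⟩
      5 + L y′       ≤⟨ m≤n+m (5 + L y′) d ⟩
      d + (5 + L y′) ∎

-- From ends of cubes to runs of zeros

cubeEndsAt⇒cubeTo : ∀ {j} → CubeEndsAt j → CubeTo (suc j)
cubeEndsAt⇒cubeTo {j} (i , m , 1≤m , eq , per) = i , m , 1≤m , trans eq (triple i m) , per′
  where
    triple : ∀ i m → i + 3 * m ≡ i + m + m + m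
    triple = solve-∀
    double : ∀ i m → i + m + m ≡ i + 2 * m
    double = solve-∀
    per′ : Per m i (i + m + m)
    per′ x i≤x x<e with m≤n⇒∃[o]m+o≡n i≤x
    ... | k , refl = trans (f≡fib (i + k)) (trans (per k (+-cancelˡ-< i k (2 * m)
          (subst (i + k <_) (double i m) x<e))) (sym (f≡fib (i + k + m))))

cubeTo⇒cubeEndsAt : ∀ {j} → CubeTo (suc j) → CubeEndsAt j
cubeTo⇒cubeEndsAt {j} (i , m , 1≤m , eq , per) = i , m , 1≤m , trans eq (triple i m) , λ k k<2m →
    trans (sym (f≡fib (i + k))) (trans
      (per (i + k) (m≤m+n i k) (subst (i + k <_) (double i m) (+-monoʳ-< i k<2m))) (f≡fib (i + k + m)))
  where
    triple : ∀ i m → i + m + m + m ≡ i + 3 * m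
    triple = solve-∀
    double : ∀ i m → i + 2 * m ≡ i + m + m
    double = solve-∀

zeroRun⇒firstCube : ∀ {i ℓ} → ZeroRun i ℓ → FirstCube (suc i) ℓ
zeroRun⇒firstCube (_ , none , c , _) =
  (λ k k<ℓ c → none k k<ℓ (cubeTo⇒cubeEndsAt c)) , cubeEndsAt⇒cubeTo c

zeroRun : ∀ {i ℓ} → 1 ≤ ℓ → FirstCube (suc i) ℓ → i ≡ 0 ⊎ ∃[ p ] (i ≡ suc p × CubeEndsAt p) → ZeroRun i ℓ
zeroRun 1≤ℓ (none , c) before =
  1≤ℓ , (λ k k<ℓ c → none k k<ℓ (cubeEndsAt⇒cubeTo c)) , cubeTo⇒cubeEndsAt c , before

runs-recur : ∀ {w ℓ} d → Recurrent w → does (nextCube (drop d w) ≟ᵐ just ℓ) ≡ true → 1 ≤ ℓ →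
             ∀ N → ∃[ i ] (N ≤ i × ZeroRun i ℓ)
-- In `6 + N`, five accounts for the inert letters and one for ends being exclusive.
runs-recur {w} {ℓ} d rec eq 1≤ℓ N with rec (6 + N)
... | y , 6+N≤y , o with m≤n⇒∃[o]m+o≡n (≤-trans 6+N≤y (m≤n+m y d))
...   | k , eq′ = suc (N + k) , m≤n⇒m≤1+n (m≤m+n N k) , run
  where
    run : ZeroRun (suc (N + k)) ℓ
    run with nextCube-sound (drop d w) (at-index (sym eq′) (drop-occurs d o)) (by-evaluation (_ ≟ᵐ _) eq)
    ... | c , first = zeroRun 1≤ℓ first (inj₂ (N + k , refl , cubeTo⇒cubeEndsAt c))

-- Found by search: the first word contains the gaps 1, 2, 3 and 7 (at offsets 4, 12, 20
-- and 28), the second contains the gap 8 (at offset 40).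
recurrent₇ recurrent₈ : List Letter
recurrent₇ = take 50 (drop 59 (prefix 11))
recurrent₈ = take 50 (drop 102 (prefix 11))

recurrent₇-recurs : Recurrent recurrent₇
-- The copy of the word inside its double image starts at offset 34.
recurrent₇-recurs = recurrent {recurrent₇} 34 50 (take-occurs 50 (drop-occurs 59 (prefix-occurs 11)))
  (by-evaluation (_ ≟ʷ _) refl)

recurrent₈-recurs : Recurrent recurrent₈
recurrent₈-recurs = recurrent {recurrent₈} 55 50 (take-occurs 50 (drop-occurs 102 (prefix-occurs 11)))
  (by-evaluation (_ ≟ʷ _) refl)

-- A run that does not start at position 0 follows the end of a cube, so its length is a gap; the
-- gap 0 between adjacent ends is not a run.
later-run : ∀ {p ℓ} → ZeroRun (suc p) ℓ → Gap ℓ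
later-run {p} run@(1≤ℓ , _ , _ , inj₂ (_ , refl , c)) with next-gap (cubeEndsAt⇒cubeTo c)
... | g , first , gap with FirstCube-unique (zeroRun⇒firstCube run) first
...   | refl with gap
...     | inj₁ refl = ⊥-elim (n≮0 1≤ℓ)
...     | inj₂ gap′ = gap′

theorem2 : (∀ i ℓ → ZeroRun i ℓ →
    ℓ ≡ 1 ⊎ ℓ ≡ 2 ⊎ ℓ ≡ 3 ⊎ ℓ ≡ 7 ⊎ ℓ ≡ 8 ⊎ ℓ ≡ 13)
    × ZeroRun 0 13
    × (∀ i → ZeroRun i 13 → i ≡ 0)
    × (∀ ℓ → (ℓ ≡ 1 ⊎ ℓ ≡ 2 ⊎ ℓ ≡ 3 ⊎ ℓ ≡ 7 ⊎ ℓ ≡ 8) →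
    ∀ N → ∃[ i ] (N ≤ i × ZeroRun i ℓ))
theorem2 = lengths , zeroRun (s≤s z≤n) first-cube (inj₁ refl) , only-first , recurring
  where
    lengths : ∀ i ℓ → ZeroRun i ℓ → ℓ ≡ 1 ⊎ ℓ ≡ 2 ⊎ ℓ ≡ 3 ⊎ ℓ ≡ 7 ⊎ ℓ ≡ 8 ⊎ ℓ ≡ 13
    lengths zero ℓ run =
      inj₂ (inj₂ (inj₂ (inj₂ (inj₂ (FirstCube-unique (zeroRun⇒firstCube run) first-cube)))))
    lengths (suc p) ℓ run with later-run run
    ... | inj₁ eq                      = inj₁ eq
    ... | inj₂ (inj₁ eq)               = inj₂ (inj₁ eq)
    ... | inj₂ (inj₂ (inj₁ eq))        = inj₂ (inj₂ (inj₁ eq))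
    ... | inj₂ (inj₂ (inj₂ (inj₁ eq))) = inj₂ (inj₂ (inj₂ (inj₁ eq)))
    ... | inj₂ (inj₂ (inj₂ (inj₂ eq))) = inj₂ (inj₂ (inj₂ (inj₂ (inj₁ eq))))

    only-first : ∀ i → ZeroRun i 13 → i ≡ 0
    only-first zero    _   = refl
    only-first (suc p) run with later-run run
    ... | inj₁ ()
    ... | inj₂ (inj₁ ())
    ... | inj₂ (inj₂ (inj₁ ()))
    ... | inj₂ (inj₂ (inj₂ (inj₁ ())))
    ... | inj₂ (inj₂ (inj₂ (inj₂ ())))

    recurring : ∀ ℓ → Gap ℓ → ∀ N → ∃[ i ] (N ≤ i × ZeroRun i ℓ)
    recurring _ (inj₁ refl)                      = runs-recur {recurrent₇} 4 recurrent₇-recurs refl (s≤s z≤n)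
    recurring _ (inj₂ (inj₁ refl))               = runs-recur {recurrent₇} 12 recurrent₇-recurs refl (s≤s z≤n)
    recurring _ (inj₂ (inj₂ (inj₁ refl)))        = runs-recur {recurrent₇} 20 recurrent₇-recurs refl (s≤s z≤n)
    recurring _ (inj₂ (inj₂ (inj₂ (inj₁ refl)))) = runs-recur {recurrent₇} 28 recurrent₇-recurs refl (s≤s z≤n)
    recurring _ (inj₂ (inj₂ (inj₂ (inj₂ refl)))) = runs-recur {recurrent₈} 40 recurrent₈-recurs refl (s≤s z≤n)
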